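{- For every Büchi automaton $A$ over the alphabet $2^{AP}$, $\mathrm{supp}(A)$ is an LTL theory, i.e., $\mathrm{Cn}_{LTL}(\mathrm{supp}(A))=\mathrm{supp}(A)$.
   Context: Fix a finite nonempty $AP$. LTL formulae $\varphi::=\bot\mid p\mid\neg\varphi\mid\varphi\lor\varphi\mid X\varphi\mid\varphi U\varphi$ with the standard trace semantics over $(2^{AP})^\omega$. Kripke structure $M=(S,I,T,\lambda)$: finite $S$, nonempty $I\subseteq S$, left-total $T$, $\lambda:S\to2^{AP}$; traces $\lambda(s_0)\lambda(s_1)\dots$ along paths from $I$; $M\models\varphi$ iff all traces of $M$ satisfy $\varphi$. $\mathrm{Cn}_{LTL}(X)$ = formulae satisfied by every Kripke structure satisfying all of $X$. Büchi automaton $A=(Q,\Sigma,\Delta,Q_0,R)$ accepts an infinite word iff there is a run from an initial state along $\Delta$ visiting $R$ infinitely often; $\mathcal{L}(A)$ its language. $\mathrm{supp}(A):=\{\varphi\mid\pi\models\varphi\ \forall\pi\in\mathcal{L}(A)\}$. -}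

module Defs where

open import Data.Empty using (⊥)
open import Data.Fin using (Fin)
open import Data.Fin.Subset using (Subset; _∈_; Nonempty)
open import Data.Nat using (ℕ; suc; _≤_; _<_)
open import Data.Product using (_×_; ∃-syntax)
open import Data.Sum using (_⊎_)
open import Level using (0ℓ)
open import Relation.Binary.PropositionalEquality using (_≡_)
open import Relation.Nullary using (¬_)
open import Relation.Unary using (Pred; _≐_)

-- AP is Fin n, and the alphabet 2^AP is Subset n.

infixr 6 _U_
infixr 5 _∨_

data LTL (n : ℕ) : Set where
  bot : LTL n
  var : Fin n → LTL n
  neg : LTL n → LTL n
  _∨_ : LTL n → LTL n → LTL n
  X   : LTL n → LTL n
  _U_ : LTL n → LTL n → LTL n

Word : Set → Set
Word Σ = ℕ → Σ

Trace : ℕ → Set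
Trace n = Word (Subset n)

infix 4 _,_⊨_ _⊨_ _⊨ᴷ_

-- π , i ⊨ φ : the suffix of π starting at position i satisfies φ.
_,_⊨_ : ∀ {n} → Trace n → ℕ → LTL n → Set
π , i ⊨ bot     = ⊥
π , i ⊨ var p   = p ∈ π i
π , i ⊨ neg φ   = ¬ (π , i ⊨ φ)
π , i ⊨ (φ ∨ ψ) = (π , i ⊨ φ) ⊎ (π , i ⊨ ψ)
π , i ⊨ X φ     = π , suc i ⊨ φ
π , i ⊨ (φ U ψ) =
  ∃[ j ] i ≤ j × (π , j ⊨ ψ) × (∀ k → i ≤ k → k < j → π , k ⊨ φ)

_⊨_ : ∀ {n} → Trace n → LTL n → Set
π ⊨ φ = π , 0 ⊨ φ

-- Transition relations are given by successor sets: (s , t) ∈ T is t ∈ T s.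
record Kripke (n : ℕ) : Set where
  field
    size        : ℕ
    I           : Subset size
    I-nonempty  : Nonempty I
    T           : Fin size → Subset size
    T-leftTotal : ∀ s → Nonempty (T s)
    label       : Fin size → Subset n

  IsPath : (ℕ → Fin size) → Set
  IsPath s = s 0 ∈ I × (∀ i → s (suc i) ∈ T (s i))

  IsTrace : Pred (Trace n) 0ℓ
  IsTrace π = ∃[ s ] IsPath s × (∀ i → π i ≡ label (s i))

_⊨ᴷ_ : ∀ {n} → Kripke n → LTL n → Set
M ⊨ᴷ φ = ∀ π → Kripke.IsTrace M π → π ⊨ φ

Cn : ∀ {n} → Pred (LTL n) 0ℓ → Pred (LTL n) 0ℓ
Cn {n} Γ φ = (M : Kripke n) → (∀ ψ → Γ ψ → M ⊨ᴷ ψ) → M ⊨ᴷ φ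

IsTheory : ∀ {n} → Pred (LTL n) 0ℓ → Set
IsTheory Γ = Cn Γ ≐ Γ

-- (q , a , q′) ∈ Δ is q′ ∈ Δ q a.
record Büchi (Σ : Set) : Set where
  field
    size : ℕ
    Δ    : Fin size → Σ → Subset size
    Q₀   : Subset size
    R    : Subset size

  IsRun : Word Σ → (ℕ → Fin size) → Set
  IsRun w r = r 0 ∈ Q₀ × (∀ i → r (suc i) ∈ Δ (r i) (w i))

  InfinitelyOftenInR : (ℕ → Fin size) → Set
  InfinitelyOftenInR r = ∀ i → ∃[ j ] i ≤ j × r j ∈ R

  Language : Pred (Word Σ) 0ℓ
  Language w = ∃[ r ] IsRun w r × InfinitelyOftenInR r

supp : ∀ {n} → Büchi (Subset n) → Pred (LTL n) 0ℓ
supp A φ = ∀ π → Büchi.Language A π → π ⊨ φ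

{-# OPTIONS --safe #-}
-- Pump an accepting run r on a word π of L(A) into a lasso: choose i < j with r i ≡ r j, with R visited
-- in [i, j), with the relevant subformulas of φ having the same truth value at i and j, and with every
-- until-subformula true at i fulfilled in [i, j).  The one-trace Kripke structure that walks 0, …, j - 1
-- and jumps back to i has its trace in L(A), hence satisfies supp A, and agrees with π on φ at the start.
module Submission where

open import Defs
open import Axiom.ExcludedMiddle using (ExcludedMiddle)
open import Data.Empty using (⊥-elim)
open import Data.Fin using (Fin; zero; suc; toℕ; fromℕ<)
open import Data.Fin.Properties using (toℕ<n; toℕ-fromℕ<)
open import Data.Fin.Subset using (Subset; ⁅_⁆; _∈_)
open import Data.Fin.Subset.Properties using (x∈⁅x⁆; x∈⁅y⁆⇒x≡y)
open import Data.Nat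
  using (ℕ; zero; suc; _+_; _∸_; _⊔_; _≤_; _<_; z≤n; s≤s; _<?_; NonZero)
open import Data.Nat.Properties
open import Data.Product using (_×_; _,_; ∃-syntax; Σ-syntax; proj₁; proj₂)
open import Data.Sum using (_⊎_; inj₁; inj₂)
open import Data.Sum.Function.Propositional using (_⊎-⇔_)
open import Data.Unit using (⊤; tt)
open import Function.Base using (_∘_)
open import Function.Bundles using (_⇔_; mk⇔; Equivalence)
open import Function.Properties.Equivalence using () renaming (trans to ⇔-trans; sym to ⇔-sym)
open import Level using (0ℓ)
open import Relation.Binary.Core using (Rel)
open import Relation.Binary.PropositionalEquality
open import Relation.Nullary using (¬_; yes; no)
open import Relation.Unary using (Pred; _⊆_; _∩_)

open Equivalence using (to; from)

-- Recurrent relations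

Infinite : Pred ℕ 0ℓ → Set
Infinite P = ∀ n → ∃[ m ] n ≤ m × P m

EventuallyRelated : Rel ℕ 0ℓ → Pred ℕ 0ℓ → Set
EventuallyRelated C P = ∀ {i} → P i → ∃[ N ] (∀ {j} → P j → N ≤ j → C i j)

-- Mere existence of a related pair is not stable under conjunction. Thinning an arbitrary infinite
-- set is, since demands can be imposed one after another. The threshold in `EventuallyRelated`
-- depends on `i`, which admits demands that hold only for late `j`.
Recurrent : Rel ℕ 0ℓ → Set₁
Recurrent C = ∀ {P} → Infinite P →
  Σ[ Q ∈ Pred ℕ 0ℓ ] Q ⊆ P × Infinite Q × EventuallyRelated C Q

recurrent⇒related : ∀ {C} → Recurrent C → ∃[ i ] ∃[ j ] i < j × C i j
recurrent⇒related rec with rec {λ _ → ⊤} (λ n → n , ≤-refl , tt)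
... | Q , _ , inf , ev with inf 0
... | i , _ , Qi with ev Qi
... | N , C-after with inf (suc i ⊔ N)
... | j , b , Qj = i , j , ≤-trans (m≤m⊔n (suc i) N) b , C-after Qj (≤-trans (m≤n⊔m (suc i) N) b)

recurrent-eventually : ∀ {C} → (∀ i → ∃[ N ] (∀ {j} → N ≤ j → C i j)) → Recurrent C
recurrent-eventually ev {P} inf = P , (λ p → p) , inf , λ {i} _ → proj₁ (ev i) , λ _ → proj₂ (ev i)

recurrent-map : ∀ {C D : Rel ℕ 0ℓ} → (∀ {i j} → C i j → D i j) → Recurrent C → Recurrent D
recurrent-map C⇒D rec inf with rec inf
... | Q , Q⊆P , infQ , ev = Q , Q⊆P , infQ , λ Qi → proj₁ (ev Qi) , λ Qj N≤j → C⇒D (proj₂ (ev Qi) Qj N≤j)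

-- Subsets inherit `C`, so the set found for `C` can be thinned again for `D`.
recurrent-× : ∀ {C D} → Recurrent C → Recurrent D → Recurrent (λ i j → C i j × D i j)
recurrent-× recC recD inf with recC inf
... | Q , Q⊆P , infQ , evC with recD infQ
... | S , S⊆Q , infS , evD = S , (λ s → Q⊆P (S⊆Q s)) , infS , λ Si →
  let M , hC = evC (S⊆Q Si)
      N , hD = evD Si
  in M ⊔ N , λ Sj b → hC (S⊆Q Sj) (≤-trans (m≤m⊔n M N) b) , hD Sj (≤-trans (m≤n⊔m M N) b)

recurrent-∀ : ∀ {m} {C : Fin m → Rel ℕ 0ℓ} → (∀ q → Recurrent (C q)) →
              Recurrent (λ i j → ∀ q → C q i j)
recurrent-∀ {zero}  rec = recurrent-eventually (λ _ → 0 , λ _ ())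
recurrent-∀ {suc m} rec =
  recurrent-map (λ { (c , cs) zero → c ; (c , cs) (suc q) → cs q })
    (recurrent-× (rec zero) (recurrent-∀ (rec ∘ suc)))

module _ (em : ExcludedMiddle 0ℓ) where

  -- Pigeonhole with two colours: if `p` eventually fails on `P`, keep the elements where it fails;
  -- otherwise `p` holds infinitely often on `P`.
  recurrent-⇔ : (p : Pred ℕ 0ℓ) → Recurrent (λ i j → p i ⇔ p j)
  recurrent-⇔ p {P} inf with em {∃[ N ] (∀ m → N ≤ m → P m → ¬ p m)}
  ... | yes (N , ¬p) =
    P ∩ (λ m → ¬ p m) , proj₁ ,
    (λ n → let m , b , Pm = inf (n ⊔ N)
           in m , ≤-trans (m≤m⊔n n N) b , Pm , ¬p m (≤-trans (m≤n⊔m n N) b) Pm) ,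
    λ (_ , ¬pi) → 0 , λ (_ , ¬pj) _ → mk⇔ (⊥-elim ∘ ¬pi) (⊥-elim ∘ ¬pj)
  ... | no ¬bounded =
    P ∩ p , proj₁ , infinite , λ (_ , pi) → 0 , λ (_ , pj) _ → mk⇔ (λ _ → pj) (λ _ → pi)
    where
    infinite : Infinite (P ∩ p)
    infinite n with em {∃[ m ] n ≤ m × P m × p m}
    ... | yes found = found
    ... | no ¬found = ⊥-elim (¬bounded (n , λ m b Pm pm → ¬found (m , b , Pm , pm)))

  -- Equality of states follows from agreement of the finitely many predicates `r k ≡ q`, by taking
  -- `q` to be `r i`.
  recurrent-≡ : ∀ {m} (r : ℕ → Fin m) → Recurrent (λ i j → r i ≡ r j)
  recurrent-≡ r = recurrent-map (λ {i} same → sym (to (same (r i)) refl))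
    (recurrent-∀ (λ q → recurrent-⇔ (λ k → r k ≡ q)))

-- Unfolding the until operator

module Until {n} (π : Trace n) (φ ψ : LTL n) where

  now : ∀ k → π , k ⊨ ψ → π , k ⊨ φ U ψ
  now k h = k , ≤-refl , h , λ m k≤m m<k → ⊥-elim (<⇒≱ m<k k≤m)

  later : ∀ k → π , k ⊨ φ → π , suc k ⊨ φ U ψ → π , k ⊨ φ U ψ
  later k h (l , k<l , hψ , hφ) = l , <⇒≤ k<l , hψ , before
    where
    before : ∀ m → k ≤ m → m < l → π , m ⊨ φ
    before m k≤m m<l with m≤n⇒m<n∨m≡n k≤m
    ... | inj₁ k<m  = hφ m k<m m<l
    ... | inj₂ refl = h

  unfold : ∀ k → π , k ⊨ φ U ψ → (π , k ⊨ ψ) ⊎ ((π , k ⊨ φ) × (π , suc k ⊨ φ U ψ))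
  unfold k (l , k≤l , hψ , hφ) with m≤n⇒m<n∨m≡n k≤l
  ... | inj₁ k<l  = inj₂ (hφ k ≤-refl k<l , l , k<l , hψ , λ m k<m → hφ m (<⇒≤ k<m))
  ... | inj₂ refl = inj₁ hψ

  -- Induction for until as a least fixed point, by recursion on the distance to the witness.
  rec : (P : Pred ℕ 0ℓ) → (∀ m → π , m ⊨ ψ → P m) →
        (∀ m → π , m ⊨ φ → P (suc m) → P m) → ∀ k → π , k ⊨ φ U ψ → P k
  rec P base step k (l , k≤l , hψ , hφ) = go (l ∸ k) k (m∸n+n≡m k≤l) hφ
    where
    go : ∀ d k → d + k ≡ l → (∀ m → k ≤ m → m < l → π , m ⊨ φ) → P k
    go zero    k refl hφ = base k hψ
    go (suc d) k refl hφ = step k (hφ k ≤-refl (s≤s (m≤n+m k d)))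
      (go d (suc k) (+-suc d k) (λ m k<m → hφ m (<⇒≤ k<m)))

-- Lassos

-- Constraints sit only at the temporal operators, where evaluation can cross the seam from `j - 1`
-- back to `i`. Equal truth values of an until at `i` and `j` would still let it be postponed around
-- the loop for ever; the last conjunct rules that out.
Loopable : ∀ {n} → Trace n → LTL n → Rel ℕ 0ℓ
Loopable π bot     i j = ⊤
Loopable π (var p) i j = ⊤
Loopable π (neg φ) i j = Loopable π φ i j
Loopable π (φ ∨ ψ) i j = Loopable π φ i j × Loopable π ψ i j
Loopable π (X φ)   i j = Loopable π φ i j × ((π , i ⊨ φ) ⇔ (π , j ⊨ φ))
Loopable π (φ U ψ) i j =
  Loopable π φ i j × Loopable π ψ i j × ((π , i ⊨ φ U ψ) ⇔ (π , j ⊨ φ U ψ)) ×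
  (π , i ⊨ φ U ψ → ∃[ w ] i ≤ w × w < j × (π , w ⊨ ψ))

recurrent-loopable : ExcludedMiddle 0ℓ → ∀ {n} (π : Trace n) φ → Recurrent (Loopable π φ)
recurrent-loopable em π bot     = recurrent-eventually (λ _ → 0 , λ _ → tt)
recurrent-loopable em π (var p) = recurrent-eventually (λ _ → 0 , λ _ → tt)
recurrent-loopable em π (neg φ) = recurrent-loopable em π φ
recurrent-loopable em π (φ ∨ ψ) =
  recurrent-× (recurrent-loopable em π φ) (recurrent-loopable em π ψ)
recurrent-loopable em π (X φ) =
  recurrent-× (recurrent-loopable em π φ) (recurrent-⇔ em (λ k → π , k ⊨ φ))
recurrent-loopable em π (φ U ψ) =
  recurrent-× (recurrent-loopable em π φ) (recurrent-× (recurrent-loopable em π ψ)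
    (recurrent-× (recurrent-⇔ em (λ k → π , k ⊨ φ U ψ)) (recurrent-eventually fulfilled)))
  where
  fulfilled : ∀ i → ∃[ N ] (∀ {j} → N ≤ j → π , i ⊨ φ U ψ → ∃[ w ] i ≤ w × w < j × (π , w ⊨ ψ))
  fulfilled i with em {π , i ⊨ φ U ψ}
  -- One witness serves every `j` beyond it, hence the threshold `suc w`; a false until demands
  -- nothing.
  ... | yes (w , i≤w , hψ , _) = suc w , λ w<j _ → w , i≤w , w<j , hψ
  ... | no ¬u                  = 0 , λ _ u → ⊥-elim (¬u u)

-- The bound on every position forces the jump: stepping forward from `j - 1` would reach `j`.
LassoWalk : ℕ → ℕ → (ℕ → ℕ) → Set
LassoWalk i j f = ∀ k → f k < j × (f (suc k) ≡ suc (f k) ⊎ (suc (f k) ≡ j × f (suc k) ≡ i))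

module _ {i j f} (walk : LassoWalk i j f) where

  -- The two positions differ only at the seam, where they are `j` and `i`.
  walk-jump : ∀ (p : Pred ℕ 0ℓ) → p i ⇔ p j → ∀ k → p (suc (f k)) ⇔ p (f (suc k))
  walk-jump p i⇔j k with proj₂ (walk k)
  ... | inj₁ eq         rewrite eq = mk⇔ (λ h → h) (λ h → h)
  ... | inj₂ (eq , eq′) rewrite eq | eq′ = mk⇔ (from i⇔j) (to i⇔j)

  walk-climb : ∀ d k → d + f k < j → f (d + k) ≡ d + f k
  walk-climb zero    k b = refl
  walk-climb (suc d) k b with walk-climb d k (<⇒≤ b) | proj₂ (walk (d + k))
  ... | ih | inj₁ eq       = trans eq (cong suc ih)
  ... | ih | inj₂ (eq , _) = ⊥-elim (<⇒≢ b (trans (cong suc (sym ih)) eq))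

  walk-returns : ∀ k → ∃[ d ] f (d + k) ≡ i
  walk-returns k = suc d , returns (proj₂ (walk (d + k)))
    where
    -- The number of steps left to the last position `j - 1`.
    d = j ∸ suc (f k)

    top : suc (d + f k) ≡ j
    top = trans (sym (+-suc d (f k))) (m∸n+n≡m (proj₁ (walk k)))

    returns : f (suc d + k) ≡ suc (f (d + k)) ⊎ (suc (f (d + k)) ≡ j × f (suc d + k) ≡ i) →
              f (suc d + k) ≡ i
    returns (inj₂ (_ , eq)) = eq
    returns (inj₁ eq)       = ⊥-elim (<⇒≢ (proj₁ (walk (suc d + k)))
      (trans eq (trans (cong suc (walk-climb d k (≤-reflexive top))) top)))

  -- Return to `i`, then climb `w ∸ i` steps without a jump.
  walk-visits : ∀ {w} → i ≤ w → w < j → ∀ k → ∃[ d ] f (d + k) ≡ w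
  walk-visits {w} i≤w w<j k with walk-returns k
  ... | d , eq = w ∸ i + d , (begin
    f (w ∸ i + d + k)   ≡⟨ cong f (+-assoc (w ∸ i) d k) ⟩
    f (w ∸ i + (d + k)) ≡⟨ walk-climb (w ∸ i) (d + k) (subst (_< j) (sym sum) w<j) ⟩
    w ∸ i + f (d + k)   ≡⟨ sum ⟩
    w                   ∎)
    where
    open ≡-Reasoning
    sum : w ∸ i + f (d + k) ≡ w
    sum = trans (cong (w ∸ i +_) eq) (m∸n+n≡m i≤w)

  module _ {n} {π σ : Trace n} (σ≡π∘f : ∀ k → σ k ≡ π (f k)) where

    module _ (φ ψ : LTL n) (φ-transfer : ∀ k → (σ , k ⊨ φ) ⇔ (π , f k ⊨ φ))
             (ψ-transfer : ∀ k → (σ , k ⊨ ψ) ⇔ (π , f k ⊨ ψ))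
             (i⇔j : (π , i ⊨ φ U ψ) ⇔ (π , j ⊨ φ U ψ)) where

      private
        module Uπ = Until π φ ψ
        module Uσ = Until σ φ ψ

      -- Least fixed point induction in `σ`; a jump is undone by passing from `i` to `j` through
      -- `i⇔j`.
      until-fold : ∀ k → σ , k ⊨ φ U ψ → π , f k ⊨ φ U ψ
      until-fold = Uσ.rec (λ m → π , f m ⊨ φ U ψ)
        (λ m h → Uπ.now (f m) (to (ψ-transfer m) h))
        (λ m h u → Uπ.later (f m) (to (φ-transfer m) h)
                     (from (walk-jump (λ l → π , l ⊨ φ U ψ) i⇔j m) u))

      -- The obligation is postponed by d steps unless it is discharged earlier.
      until-carry : ∀ d k → (π , f (d + k) ⊨ φ U ψ → σ , d + k ⊨ φ U ψ) →
                    π , f k ⊨ φ U ψ → σ , k ⊨ φ U ψ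
      until-carry zero    k end u = end u
      until-carry (suc d) k end u with Uπ.unfold (f k) u
      ... | inj₁ here        = Uσ.now k (from (ψ-transfer k) here)
      ... | inj₂ (here , u′) = Uσ.later k (from (φ-transfer k) here)
        (until-carry d (suc k)
          (subst (λ l → π , f l ⊨ φ U ψ → σ , l ⊨ φ U ψ) (sym (+-suc d k)) end)
          (to (walk-jump (λ l → π , l ⊨ φ U ψ) i⇔j k) u′))

      -- The witness in `π` may lie beyond `j`, where the walk never goes. So the obligation is
      -- carried to a later visit of `i`, and from there to a visit of a witness `w` inside the
      -- loop.
      until-unfold : (π , i ⊨ φ U ψ → ∃[ w ] i ≤ w × w < j × (π , w ⊨ ψ)) →
                     ∀ k → π , f k ⊨ φ U ψ → σ , k ⊨ φ U ψ
      until-unfold fulfilled k with walk-returns k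
      ... | d , at-i = until-carry d k loop
        where
        loop : π , f (d + k) ⊨ φ U ψ → σ , d + k ⊨ φ U ψ
        loop u with fulfilled (subst (λ m → π , m ⊨ φ U ψ) at-i u)
        ... | w , i≤w , w<j , hw with walk-visits i≤w w<j (d + k)
        ... | e , at-w = until-carry e (d + k) (λ _ → Uσ.now (e + (d + k))
          (from (ψ-transfer (e + (d + k))) (subst (λ m → π , m ⊨ ψ) (sym at-w) hw))) u

    lasso-⊨ : ∀ φ → Loopable π φ i j → ∀ k → (σ , k ⊨ φ) ⇔ (π , f k ⊨ φ)
    lasso-⊨ bot     _ k = mk⇔ (λ ()) (λ ())
    lasso-⊨ (var p) _ k = mk⇔ (subst (p ∈_) (σ≡π∘f k)) (subst (p ∈_) (sym (σ≡π∘f k)))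
    lasso-⊨ (neg φ) c k = mk⇔ (_∘ from (lasso-⊨ φ c k)) (_∘ to (lasso-⊨ φ c k))
    lasso-⊨ (φ ∨ ψ) (c , d) k = lasso-⊨ φ c k ⊎-⇔ lasso-⊨ ψ d k
    lasso-⊨ (X φ) (c , i⇔j) k =
      ⇔-trans (lasso-⊨ φ c (suc k)) (⇔-sym (walk-jump (λ l → π , l ⊨ φ) i⇔j k))
    lasso-⊨ (φ U ψ) (c , d , i⇔j , fulfilled) k = mk⇔
      (until-fold φ ψ (lasso-⊨ φ c) (lasso-⊨ ψ d) i⇔j k)
      (until-unfold φ ψ (lasso-⊨ φ c) (lasso-⊨ ψ d) i⇔j fulfilled k)

-- The lasso as a Kripke structure

module _ {n} (π : Trace n) {i j} (i<j : i < j) where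

  lasso-start : Fin j
  lasso-start = fromℕ< (≤-<-trans z≤n i<j)

  lasso-next : Fin j → Fin j
  lasso-next x with suc (toℕ x) <? j
  ... | yes b = fromℕ< b
  ... | no  _ = fromℕ< i<j

  toℕ-lasso-next : ∀ x → toℕ (lasso-next x) ≡ suc (toℕ x) ⊎ (suc (toℕ x) ≡ j × toℕ (lasso-next x) ≡ i)
  toℕ-lasso-next x with suc (toℕ x) <? j
  ... | yes b = inj₁ (toℕ-fromℕ< b)
  ... | no ¬b = inj₂ (≤-antisym (toℕ<n x) (≮⇒≥ ¬b) , toℕ-fromℕ< i<j)

  lasso : Kripke n
  lasso = record
    { size        = j
    ; I           = ⁅ lasso-start ⁆
    ; I-nonempty  = lasso-start , x∈⁅x⁆ lasso-start
    ; T           = λ s → ⁅ lasso-next s ⁆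
    ; T-leftTotal = λ s → lasso-next s , x∈⁅x⁆ (lasso-next s)
    ; label       = λ s → π (toℕ s)
    }

  lasso-path : ℕ → Fin j
  lasso-path zero    = lasso-start
  lasso-path (suc k) = lasso-next (lasso-path k)

  lasso-path-isPath : Kripke.IsPath lasso lasso-path
  lasso-path-isPath = x∈⁅x⁆ lasso-start , λ k → x∈⁅x⁆ (lasso-path (suc k))

  module _ {s} (path : Kripke.IsPath lasso s) where

    path-start : toℕ (s 0) ≡ 0
    path-start = trans (cong toℕ (x∈⁅y⁆⇒x≡y _ (proj₁ path))) (toℕ-fromℕ< _)

    -- Singleton successor sets leave a path no choice but `lasso-next`.
    path-walk : LassoWalk i j (toℕ ∘ s)
    path-walk k rewrite x∈⁅y⁆⇒x≡y _ (proj₂ path k) = toℕ<n (s k) , toℕ-lasso-next (s k)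

-- Closure of the support under consequence

supp-closed : ExcludedMiddle 0ℓ → ∀ {n} (A : Büchi (Subset n)) → Cn (supp A) ⊆ supp A
supp-closed em {n} A {φ} φ∈Cn π (r , (r₀ , r-step) , r-inf) with
  -- A single pair must serve three purposes: `r` closes into a loop, the loop meets `R`, and the
  -- truth of `φ` survives the pumping.
  recurrent⇒related (recurrent-× (recurrent-≡ em r)
    (recurrent-× (recurrent-eventually visited) (recurrent-loopable em π φ)))
  where
  visited : ∀ i → ∃[ N ] (∀ {j} → N ≤ j → ∃[ w ] i ≤ w × w < j × r w ∈ Büchi.R A)
  visited i = let w , i≤w , h = r-inf i in suc w , λ w<j → w , i≤w , w<j , h
... | i , j , i<j , ri≡rj , (w , i≤w , w<j , rw∈R) , loopable =
  subst (λ m → π , m ⊨ φ) (path-start π i<j isPath)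
    (to (lasso-⊨ (path-walk π i<j isPath) (λ _ → refl) φ loopable 0)
      (φ∈Cn (lasso π i<j) lasso⊨supp _ (_ , isPath , λ _ → refl)))
  where
  isPath : Kripke.IsPath (lasso π i<j) (lasso-path π i<j)
  isPath = lasso-path-isPath π i<j

  -- Reading `r` along the walk gives a run, since `r i` and `r j` agree at the seam, and the
  -- position `w` with `r w` in `R` is revisited for ever.
  trace-accepted : ∀ {σ} → Kripke.IsTrace (lasso π i<j) σ → Büchi.Language A σ
  trace-accepted {σ} (s , path , σ≡) =
    r ∘ toℕ ∘ s ,
    (subst (λ m → r m ∈ Büchi.Q₀ A) (sym (path-start π i<j path)) r₀ , step) ,
    λ k → let d , eq = walk-visits walk i≤w w<j k
          in d + k , m≤n+m k d , subst (λ m → r m ∈ Büchi.R A) (sym eq) rw∈R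
    where
    walk : LassoWalk i j (toℕ ∘ s)
    walk = path-walk π i<j path

    step : ∀ k → r (toℕ (s (suc k))) ∈ Büchi.Δ A (r (toℕ (s k))) (σ k)
    step k rewrite σ≡ k =
      to (walk-jump walk (λ m → r m ∈ D) (mk⇔ (subst (_∈ D) ri≡rj) (subst (_∈ D) (sym ri≡rj))) k)
         (r-step (toℕ (s k)))
      where D = Büchi.Δ A (r (toℕ (s k))) (π (toℕ (s k)))

  lasso⊨supp : ∀ ψ → supp A ψ → lasso π i<j ⊨ᴷ ψ
  lasso⊨supp ψ ψ∈supp σ trace = ψ∈supp σ (trace-accepted trace)

mainTheorem13 : ExcludedMiddle 0ℓ →
    (n : ℕ) → .{{_ : NonZero n}} →
    (A : Büchi (Subset n)) → IsTheory (supp A)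
-- The converse inclusion holds for any set of formulae.
mainTheorem13 em n A = (λ {φ} → supp-closed em A {φ}) , λ {φ} φ∈supp M M⊨supp → M⊨supp φ φ∈supp
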